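{- Let $g \ge h \ge 2$ be integers. There is a constant $C>0$ depending only on $g$ and $h$ such that for every positive integer $n$ and every $C_h[g]$ set $A \subset \{1,2,\dots,n\}$, $$|A| \le (g-1)^{1/h}\, n^{1-\frac{1}{h}} + C\, n^{\frac{1}{2}-\frac{1}{2h}}.$$
   Context: A set of integers $A$ is called a $C_h[g]$ set if for every set $X$ of $h$ integers there do not exist $g$ distinct integers $k_1,\dots,k_g$ such that $X+k_i \subset A$ for all $i=1,\dots,g$ (here $X+k=\{x+k : x\in X\}$). In words, $A$ contains no $g$ distinct translates of a common $h$-element set. -}

module Defs where

open import Level using (0ℓ)
open import Data.Nat as ℕ using (ℕ; zero; suc)
import Data.Nat.Properties as ℕₚ
open import Data.Integer as ℤ using (ℤ; +_)
import Data.Integer.Properties as ℤₚ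
open import Data.Rational using (ℚ; mkℚ; 0ℚ; 1ℚ; ½; _+_; _*_; _-_; -_; ∣_∣; _≤_; _<_; _/_; 1/_; toℚᵘ; *<*; Positive; positive; NonZero; nonNegative)
open import Data.Rational.Properties
open import Data.Rational.Solver using (module +-*-Solver)
import Data.Rational.Unnormalised as ℚᵘ
import Data.Rational.Unnormalised.Properties as ℚᵘₚ
open import Data.Fin using (Fin; toℕ)
open import Data.Fin.Subset as Subset using (Subset)
open import Data.Product using (Σ; ∃; _×_; _,_; proj₁)
open import Data.Sum using (inj₁; inj₂)
open import Function.Definitions using (Injective)
open import Relation.Nullary using (¬_; yes; no)
open import Relation.Unary using (Pred; _∈_)
open import Relation.Binary.PropositionalEquality using (_≡_; refl; sym; trans; cong; subst)

Cauchy : (ℕ → ℚ) → Set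
Cauchy x = ∀ ε → 0ℚ < ε → ∃ λ N → ∀ m n → N ℕ.≤ m → N ℕ.≤ n → ∣ x m - x n ∣ ≤ ε

record ℝ : Set where
  constructor mkℝ
  field
    seq    : ℕ → ℚ
    cauchy : Cauchy seq

open ℝ public

infix  4 _≤ᴿ_ _<ᴿ_
infixl 6 _+ᴿ_
infixl 7 _*ᴿ_

-- Order of the limits, not pointwise order of the sequences.
_≤ᴿ_ : ℝ → ℝ → Set
x ≤ᴿ y = ∀ ε → 0ℚ < ε → ∃ λ N → ∀ m → N ℕ.≤ m → seq x m ≤ seq y m + ε

_<ᴿ_ : ℝ → ℝ → Set
x <ᴿ y = ∃ λ ε → 0ℚ < ε × ∃ λ N → ∀ m → N ℕ.≤ m → seq x m + ε ≤ seq y m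

private
  ½ε>0 : ∀ {ε} → 0ℚ < ε → 0ℚ < ½ * ε
  ½ε>0 {ε} ε>0 = positive⁻¹ (½ * ε) {{pos*pos⇒pos ½ ε {{positive ε>0}}}}

  ½ε+½ε : ∀ ε → ½ * ε + ½ * ε ≡ ε
  ½ε+½ε ε = trans (sym (*-distribʳ-+ ε ½ ½)) (*-identityˡ ε)

  split-+ : ∀ a b c d → (a + b) - (c + d) ≡ (a - c) + (b - d)
  split-+ = solve 4 (λ a b c d → (a :+ b) :- (c :+ d) := (a :- c) :+ (b :- d)) refl
    where open +-*-Solver

  split-* : ∀ a b c d → a * b - c * d ≡ a * (b - d) + (a - c) * d
  split-* = solve 4 (λ a b c d → a :* b :- c :* d := a :* (b :- d) :+ (a :- c) :* d) refl
    where open +-*-Solver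

  const-cauchy : ∀ q → Cauchy (λ _ → q)
  const-cauchy q ε ε>0 = 0 , λ _ _ _ _ →
    subst (_≤ ε) (sym (cong ∣_∣ (+-inverseʳ q))) (<⇒≤ ε>0)

  +-cauchy : ∀ {x y} → Cauchy x → Cauchy y → Cauchy (λ m → x m + y m)
  +-cauchy {x} {y} cx cy ε ε>0 with cx (½ * ε) (½ε>0 ε>0) | cy (½ * ε) (½ε>0 ε>0)
  ... | N₁ , p₁ | N₂ , p₂ = N₁ ℕ.⊔ N₂ , λ m n N≤m N≤n → begin
    ∣ (x m + y m) - (x n + y n) ∣    ≡⟨ cong ∣_∣ (split-+ (x m) (y m) (x n) (y n)) ⟩
    ∣ (x m - x n) + (y m - y n) ∣    ≤⟨ ∣p+q∣≤∣p∣+∣q∣ (x m - x n) (y m - y n) ⟩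
    ∣ x m - x n ∣ + ∣ y m - y n ∣    ≤⟨ +-mono-≤
      (p₁ m n (ℕₚ.m⊔n≤o⇒m≤o N₁ N₂ N≤m) (ℕₚ.m⊔n≤o⇒m≤o N₁ N₂ N≤n))
      (p₂ m n (ℕₚ.m⊔n≤o⇒n≤o N₁ N₂ N≤m) (ℕₚ.m⊔n≤o⇒n≤o N₁ N₂ N≤n)) ⟩
    ½ * ε + ½ * ε                    ≡⟨ ½ε+½ε ε ⟩
    ε                                ∎
    where open ≤-Reasoning

  Bound : (ℕ → ℚ) → Set
  Bound x = ∃ λ B → 0ℚ < B × ∃ λ N → ∀ m → N ℕ.≤ m → ∣ x m ∣ ≤ B

  bounded : ∀ {x} → Cauchy x → Bound x
  bounded {x} cx with cx 1ℚ (positive⁻¹ 1ℚ)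
  ... | N , p = 1ℚ + ∣ x N ∣ , +-mono-<-≤ (positive⁻¹ 1ℚ) (0≤∣p∣ (x N)) , N , λ m N≤m → begin
    ∣ x m ∣                    ≡⟨ cong ∣_∣ (split (x m) (x N)) ⟩
    ∣ (x m - x N) + x N ∣      ≤⟨ ∣p+q∣≤∣p∣+∣q∣ (x m - x N) (x N) ⟩
    ∣ x m - x N ∣ + ∣ x N ∣    ≤⟨ +-monoˡ-≤ ∣ x N ∣ (p m N N≤m ℕₚ.≤-refl) ⟩
    1ℚ + ∣ x N ∣               ∎
    where
    open ≤-Reasoning
    split : ∀ a b → a ≡ (a - b) + b
    split = solve 2 (λ a b → a := (a :- b) :+ b) refl
      where open +-*-Solver

  *-mono-≤ : ∀ {a b c d} → 0ℚ ≤ a → 0ℚ ≤ d → a ≤ b → c ≤ d → a * c ≤ b * d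
  *-mono-≤ {a} {b} {c} {d} 0≤a 0≤d a≤b c≤d = ≤-trans
    (*-monoˡ-≤-nonNeg a {{nonNegative 0≤a}} c≤d)
    (*-monoʳ-≤-nonNeg d {{nonNegative 0≤d}} a≤b)

  divide : ∀ S ε → 0ℚ < S → 0ℚ < ε → ∃ λ δ → 0ℚ < δ × S * δ ≡ ε
  divide S ε S>0 ε>0 = t * ε , positive⁻¹ (t * ε) {{pos*pos⇒pos t {{1/pos⇒pos S {{S-pos}}}} ε {{positive ε>0}}}} ,
    trans (sym (*-assoc S t ε)) (trans (cong (_* ε) (*-inverseʳ S {{S-nonZero}})) (*-identityˡ ε))
    where
    S-pos : Positive S
    S-pos = positive S>0
    S-nonZero : NonZero S
    S-nonZero = pos⇒nonZero S {{S-pos}}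
    t : ℚ
    t = (1/ S) {{S-nonZero}}

  product-close : ∀ a b c d B D δ → 0ℚ ≤ D → 0ℚ ≤ δ → ∣ a ∣ ≤ B → ∣ d ∣ ≤ D →
                  ∣ a - c ∣ ≤ δ → ∣ b - d ∣ ≤ δ → ∣ a * b - c * d ∣ ≤ (B + D) * δ
  product-close a b c d B D δ 0≤D 0≤δ a≤B d≤D ac bd =
    subst (_≤ (B + D) * δ) (cong ∣_∣ (sym (split-* a b c d)))
    (≤-trans (∣p+q∣≤∣p∣+∣q∣ u v)
    (subst (∣ u ∣ + ∣ v ∣ ≤_) total (+-mono-≤ {∣ u ∣} {B * δ} {∣ v ∣} {δ * D} u≤ v≤)))
    where
    u v : ℚ
    u = a * (b - d)
    v = (a - c) * d
    u≤ : ∣ u ∣ ≤ B * δ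
    u≤ = subst (_≤ B * δ) (sym (∣p*q∣≡∣p∣*∣q∣ a (b - d)))
      (*-mono-≤ {∣ a ∣} {B} {∣ b - d ∣} {δ} (0≤∣p∣ a) 0≤δ a≤B bd)
    v≤ : ∣ v ∣ ≤ δ * D
    v≤ = subst (_≤ δ * D) (sym (∣p*q∣≡∣p∣*∣q∣ (a - c) d))
      (*-mono-≤ {∣ a - c ∣} {δ} {∣ d ∣} {D} (0≤∣p∣ (a - c)) 0≤D ac d≤D)
    total : B * δ + δ * D ≡ (B + D) * δ
    total = trans (cong (λ t → B * δ + t) (*-comm δ D)) (sym (*-distribʳ-+ δ B D))

  *-cauchy : ∀ {x y} → Cauchy x → Cauchy y → Cauchy (λ m → x m * y m)
  *-cauchy {x} {y} cx cy ε ε>0 =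
    let B , _   , M₁ , b₁ = bounded {x} cx
        D , D>0 , M₂ , b₂ = bounded {y} cy
        δ , δ>0 , eq      = δ-for (bounded {x} cx) (bounded {y} cy)
        N₁ , p₁           = cx δ δ>0
        N₂ , p₂           = cy δ δ>0
        K₁ = M₁ ℕ.⊔ M₂
        K₂ = N₁ ℕ.⊔ N₂
    in K₁ ℕ.⊔ K₂ , λ m n K≤m K≤n →
      let m₁ = ℕₚ.m⊔n≤o⇒m≤o K₁ K₂ K≤m
          m₂ = ℕₚ.m⊔n≤o⇒n≤o K₁ K₂ K≤m
          n₁ = ℕₚ.m⊔n≤o⇒m≤o K₁ K₂ K≤n
          n₂ = ℕₚ.m⊔n≤o⇒n≤o K₁ K₂ K≤n
      in ≤-trans
        (product-close (x m) (y m) (x n) (y n) B D δ (<⇒≤ D>0) (<⇒≤ δ>0)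
          (b₁ m (ℕₚ.m⊔n≤o⇒m≤o M₁ M₂ m₁)) (b₂ n (ℕₚ.m⊔n≤o⇒n≤o M₁ M₂ n₁))
          (p₁ m n (ℕₚ.m⊔n≤o⇒m≤o N₁ N₂ m₂) (ℕₚ.m⊔n≤o⇒m≤o N₁ N₂ n₂))
          (p₂ m n (ℕₚ.m⊔n≤o⇒n≤o N₁ N₂ m₂) (ℕₚ.m⊔n≤o⇒n≤o N₁ N₂ n₂)))
        (≤-reflexive eq)
    where
    δ-for : (b : Bound x) (d : Bound y) → ∃ λ δ → 0ℚ < δ × (proj₁ b + proj₁ d) * δ ≡ ε
    δ-for (B , B>0 , _) (D , D>0 , _) = divide (B + D) ε (+-mono-< B>0 D>0) ε>0

_+ᴿ_ : ℝ → ℝ → ℝ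
seq    (x +ᴿ y) m = seq x m + seq y m
cauchy (x +ᴿ y)   = +-cauchy {seq x} {seq y} (cauchy x) (cauchy y)

_*ᴿ_ : ℝ → ℝ → ℝ
seq    (x *ᴿ y) m = seq x m * seq y m
cauchy (x *ᴿ y)   = *-cauchy {seq x} {seq y} (cauchy x) (cauchy y)

fromℚ : ℚ → ℝ
seq    (fromℚ q) _ = q
cauchy (fromℚ q)   = const-cauchy q

fromℕ : ℕ → ℝ
fromℕ n = fromℚ (+ n / 1)

0ᴿ : ℝ
0ᴿ = fromℚ 0ℚ

-- The largest r ≤ b with r ^ k ≤ N, or 0 if there is none.
rootBelow : (k N b : ℕ) → ℕ
rootBelow k N zero    = 0
rootBelow k N (suc b) with suc b ℕ.^ k ℕ.≤? N
... | yes _ = suc b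
... | no  _ = rootBelow k N b

-- ⌊ N^(1/k) ⌋ for k ≥ 1, by iroot-lower and iroot-upper.
iroot : (k N : ℕ) → ℕ
iroot k N = rootBelow k N N

rootBelow-lower : ∀ k N b → rootBelow (suc k) N b ℕ.^ suc k ℕ.≤ N
rootBelow-lower k N zero = ℕ.z≤n
rootBelow-lower k N (suc b) with suc b ℕ.^ suc k ℕ.≤? N
... | yes p = p
... | no  _ = rootBelow-lower k N b

rootBelow-upper : ∀ k N b → N ℕ.< suc b ℕ.^ suc k → N ℕ.< suc (rootBelow (suc k) N b) ℕ.^ suc k
rootBelow-upper k N zero    lt = lt
rootBelow-upper k N (suc b) lt with suc b ℕ.^ suc k ℕ.≤? N
... | yes _ = lt
... | no ¬p = rootBelow-upper k N b (ℕₚ.≰⇒> ¬p)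

iroot-lower : ∀ k N → iroot (suc k) N ℕ.^ suc k ℕ.≤ N
iroot-lower k N = rootBelow-lower k N N

iroot-upper : ∀ k N → N ℕ.< suc (iroot (suc k) N) ℕ.^ suc k
iroot-upper k N = rootBelow-upper k N N (ℕₚ.m≤m*n (suc N) (suc N ℕ.^ k) {{ℕₚ.m^n≢0 (suc N) k}})

-- ⌊ (m+1) N^(1/k) ⌋ / (m+1), within 1/(m+1) of N^(1/k).
rootApprox : (k N m : ℕ) → ℚ
rootApprox k N m = + iroot k (N ℕ.* suc m ℕ.^ k) / suc m

^-distribʳ-* : ∀ a b k → (a ℕ.* b) ℕ.^ k ≡ a ℕ.^ k ℕ.* b ℕ.^ k
^-distribʳ-* a b zero    = refl
^-distribʳ-* a b (suc k) = trans (cong ((a ℕ.* b) ℕ.*_) (^-distribʳ-* a b k))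
  (ℕₚ.[m*n]*[o*p]≡[m*o]*[n*p] a b (a ℕ.^ k) (b ℕ.^ k))

^-cancelˡ-< : ∀ k {a b} → a ℕ.^ k ℕ.< b ℕ.^ k → a ℕ.< b
^-cancelˡ-< k {a} {b} lt = ℕₚ.≰⇒> λ b≤a → ℕₚ.<⇒≱ lt (ℕₚ.^-monoˡ-≤ k b≤a)

iroot-cross : ∀ k N m n → iroot (suc k) (N ℕ.* suc m ℕ.^ suc k) ℕ.* suc n
            ℕ.< suc (iroot (suc k) (N ℕ.* suc n ℕ.^ suc k)) ℕ.* suc m
iroot-cross k N m n = ^-cancelˡ-< K (begin-strict
  (r ℕ.* suc n) ℕ.^ K                    ≡⟨ ^-distribʳ-* r (suc n) K ⟩
  r ℕ.^ K ℕ.* suc n ℕ.^ K                ≤⟨ ℕₚ.*-monoˡ-≤ (suc n ℕ.^ K) (iroot-lower k (N ℕ.* suc m ℕ.^ K)) ⟩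
  N ℕ.* suc m ℕ.^ K ℕ.* suc n ℕ.^ K      ≡⟨ ℕₚ.*-assoc N _ _ ⟩
  N ℕ.* (suc m ℕ.^ K ℕ.* suc n ℕ.^ K)    ≡⟨ cong (N ℕ.*_) (ℕₚ.*-comm (suc m ℕ.^ K) _) ⟩
  N ℕ.* (suc n ℕ.^ K ℕ.* suc m ℕ.^ K)    ≡⟨ ℕₚ.*-assoc N _ _ ⟨
  N ℕ.* suc n ℕ.^ K ℕ.* suc m ℕ.^ K      <⟨ ℕₚ.*-monoˡ-< (suc m ℕ.^ K) {{ℕₚ.m^n≢0 (suc m) K}} (iroot-upper k (N ℕ.* suc n ℕ.^ K)) ⟩
  suc s ℕ.^ K ℕ.* suc m ℕ.^ K            ≡⟨ ^-distribʳ-* (suc s) (suc m) K ⟨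
  (suc s ℕ.* suc m) ℕ.^ K                ∎)
  where
  open ℕₚ.≤-Reasoning
  K = suc k
  r = iroot K (N ℕ.* suc m ℕ.^ K)
  s = iroot K (N ℕ.* suc n ℕ.^ K)

toℚᵘ-/ : ∀ a m → toℚᵘ (+ a / suc m) ℚᵘ.≃ ℚᵘ.mkℚᵘ (+ a) m
toℚᵘ-/ a m = toℚᵘ-fromℚᵘ (ℚᵘ.mkℚᵘ (+ a) m)

/-mono-≤ : ∀ a m b n → a ℕ.* suc n ℕ.≤ b ℕ.* suc m → + a / suc m ≤ + b / suc n
/-mono-≤ a m b n le = toℚᵘ-cancel-≤ (ℚᵘₚ.≤-trans (ℚᵘₚ.≤-reflexive (toℚᵘ-/ a m))
  (ℚᵘₚ.≤-trans (ℚᵘ.*≤* (subst₂′ (ℤₚ.pos-* a (suc n)) (ℤₚ.pos-* b (suc m)) (ℤ.+≤+ le)))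
  (ℚᵘₚ.≤-reflexive (ℚᵘₚ.≃-sym (toℚᵘ-/ b n)))))
  where
  subst₂′ : ∀ {x x′ y y′} → x ≡ x′ → y ≡ y′ → x ℤ.≤ y → x′ ℤ.≤ y′
  subst₂′ refl refl p = p

suc-/ : ∀ a n → + suc a / suc n ≡ + a / suc n + + 1 / suc n
suc-/ a n = toℚᵘ-injective (ℚᵘₚ.≃-trans (toℚᵘ-/ (suc a) n) (ℚᵘₚ.≃-trans eq (ℚᵘₚ.≃-sym
  (ℚᵘₚ.≃-trans (toℚᵘ-homo-+ (+ a / suc n) (+ 1 / suc n)) (ℚᵘₚ.+-cong (toℚᵘ-/ a n) (toℚᵘ-/ 1 n))))))
  where
  d = + suc n
  eq : ℚᵘ.mkℚᵘ (+ suc a) n ℚᵘ.≃ ℚᵘ.mkℚᵘ (+ a) n ℚᵘ.+ ℚᵘ.mkℚᵘ (+ 1) n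
  eq = ℚᵘ.*≡* (trans (cong (+ suc a ℤ.*_) (ℤₚ.pos-* (suc n) (suc n)))
    (trans (sym (ℤₚ.*-assoc (+ suc a) d d))
    (cong (ℤ._* d) (trans (cong (ℤ._* d) (cong +_ (ℕₚ.+-comm 1 a))) (ℤₚ.*-distribʳ-+ d (+ a) (+ 1))))))

rootApprox-close : ∀ k N m n → rootApprox (suc k) N m ≤ rootApprox (suc k) N n + + 1 / suc n
rootApprox-close k N m n = subst (rootApprox (suc k) N m ≤_)
  (suc-/ (iroot (suc k) (N ℕ.* suc n ℕ.^ suc k)) n)
  (/-mono-≤ (iroot (suc k) (N ℕ.* suc m ℕ.^ suc k)) m (suc (iroot (suc k) (N ℕ.* suc n ℕ.^ suc k))) n (ℕₚ.<⇒≤ (iroot-cross k N m n)))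

∣-∣≤ : ∀ {x y ε} → x ≤ y + ε → y ≤ x + ε → ∣ x - y ∣ ≤ ε
∣-∣≤ {x} {y} {ε} p q with ∣p∣≡p∨∣p∣≡-p (x - y)
... | inj₁ e = subst (_≤ ε) (sym e) (subst (x - y ≤_) (lem y ε) (+-monoˡ-≤ (- y) p))
  where
  lem : ∀ y ε → y + ε - y ≡ ε
  lem = solve 2 (λ y ε → y :+ ε :- y := ε) refl where open +-*-Solver
... | inj₂ e = subst (_≤ ε) (trans (lem′ x y) (sym e)) (subst (y - x ≤_) (lem x ε) (+-monoˡ-≤ (- x) q))
  where
  lem : ∀ y ε → y + ε - y ≡ ε
  lem = solve 2 (λ y ε → y :+ ε :- y := ε) refl where open +-*-Solver
  lem′ : ∀ x y → y - x ≡ - (x - y)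
  lem′ = solve 2 (λ x y → y :- x := :- (x :- y)) refl where open +-*-Solver

archimedean : ∀ ε → 0ℚ < ε → ∃ λ N → ∀ n → N ℕ.≤ n → + 1 / suc n ≤ ε
archimedean ε@(mkℚ (+ suc a) d _) _ = d , λ n d≤n → subst (+ 1 / suc n ≤_) (↥p/↧p≡p ε)
  (/-mono-≤ 1 n (suc a) d (ℕₚ.≤-trans (ℕₚ.≤-reflexive (ℕₚ.*-identityˡ (suc d)))
    (ℕₚ.≤-trans (ℕ.s≤s d≤n) (ℕₚ.m≤m+n (suc n) (a ℕ.* suc n)))))
archimedean (mkℚ (+ 0) d _)         (*<* (ℤ.+<+ lt)) with () ← ℕₚ.<⇒≱ lt ℕ.z≤n
archimedean (mkℚ (ℤ.-[1+ a ]) d _)  (*<* ())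

rootApprox-cauchy : ∀ k N → Cauchy (rootApprox (suc k) N)
rootApprox-cauchy k N ε ε>0 with archimedean ε ε>0
... | M , p = M , λ m n M≤m M≤n → ∣-∣≤
  (≤-trans (rootApprox-close k N m n) (+-monoʳ-≤ (rootApprox (suc k) N n) (p n M≤n)))
  (≤-trans (rootApprox-close k N n m) (+-monoʳ-≤ (rootApprox (suc k) N m) (p m M≤m)))

-- root k N = N^(1/k); the value 0 for k = 0 is a convention.
root : (k N : ℕ) → ℝ
root zero    N = 0ᴿ
root (suc k) N = mkℝ (rootApprox (suc k) N) (rootApprox-cauchy k N)

infix 8 _^[_÷_]

-- n ^[ p ÷ q ] = n^(p/q)
_^[_÷_] : (n p q : ℕ) → ℝ
n ^[ p ÷ q ] = root q (n ℕ.^ p)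

-- The C_h[g] property; the h-element set X and the g distinct shifts are given by injective enumerations.
IsC : (h g : ℕ) → Pred ℤ 0ℓ → Set
IsC h g A = (X : Fin h → ℤ) → Injective _≡_ _≡_ X →
  ¬ (Σ (Fin g → ℤ) λ k → Injective _≡_ _≡_ k × (∀ i j → X j ℤ.+ k i ∈ A))

-- A : Subset n as a set of integers contained in {1, …, n}: index i stands for i + 1.
⟦_⟧ : ∀ {n} → Subset n → Pred ℤ 0ℓ
⟦_⟧ {n} A z = Σ (Fin n) λ i → (i Subset.∈ A) × z ≡ + suc (toℕ i)

{-# OPTIONS --safe #-}

-- Slide a window of length u over {1, …, n}; there are u + n positions t, and the window at t meets A in
-- a_t elements with Σ a_t ≥ u |A|.  For a fixed h-tuple of distinct offsets in the window, the positions t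
-- that carry it into A are distinct translates of one h-element set, so there are at most g - 1 of them.
-- Counting pairs (position, tuple) in two ways gives Σ (a_t - h + 1)^h ≤ (g - 1) u^h, and the power mean
-- inequality turns this into |A| ≤ (g - 1)^(1/h) (n + u)^(1 - 1/h) + (h - 1)(n + u)/u.
-- Finally u is taken of order n^(1/2 + 1/2h).
module Submission where

open import Algebra.Bundles using (module AbelianGroup)
open import Data.Bool using (Bool; T; true; false; _∧_; not; if_then_else_)
open import Data.Bool.Properties using (∧-identityʳ)
open import Data.Fin using (Fin; zero; suc; toℕ)
open import Data.Fin.Subset using (Subset; ∣_∣; outside) renaming (_∈_ to _∈ˢ_)
open import Data.Integer as ℤ using (_⊖_) renaming (+_ to pos)
import Data.Integer.Properties as ℤₚ
open import Data.Nat
open import Data.Nat.Properties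
open import Data.Nat.Tactic.RingSolver using (solve-∀)
open import Data.Product using (Σ; ∃; _×_; _,_)
import Data.Rational as ℚ
import Data.Rational.Properties as ℚₚ
import Data.Rational.Unnormalised as ℚᵘ
import Data.Rational.Unnormalised.Properties as ℚᵘₚ
open import Data.Sum using (inj₁; inj₂)
open import Data.Vec using (Vec; []; _∷_; lookup; _++_; replicate; here; there)
open import Function using (_∘_)
open import Function.Definitions using (Injective)
open import Relation.Binary.PropositionalEquality
open import Relation.Nullary using (contradiction)
open import Algebra.Properties.Group (AbelianGroup.group ℤₚ.+-0-abelianGroup) using (∙-cancelʳ)
open import Defs

-- Finite sums

∑ : ℕ → (ℕ → ℕ) → ℕ
∑ zero    f = 0
∑ (suc n) f = f 0 + ∑ n (f ∘ suc)

∑-mono-≤ : ∀ n {f g} → (∀ i → f i ≤ g i) → ∑ n f ≤ ∑ n g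
∑-mono-≤ zero    le = z≤n
∑-mono-≤ (suc n) le = +-mono-≤ (le 0) (∑-mono-≤ n (le ∘ suc))

∑-mono-≤-< : ∀ n {f g} → (∀ i → i < n → f i ≤ g i) → ∑ n f ≤ ∑ n g
∑-mono-≤-< zero    le = z≤n
∑-mono-≤-< (suc n) le = +-mono-≤ (le 0 z<s) (∑-mono-≤-< n λ i i<n → le (suc i) (s<s i<n))

∑-const : ∀ n c → ∑ n (λ _ → c) ≡ n * c
∑-const zero    c = refl
∑-const (suc n) c = cong (c +_) (∑-const n c)

∑-+ : ∀ n f g → ∑ n (λ i → f i + g i) ≡ ∑ n f + ∑ n g
∑-+ zero    f g = refl
∑-+ (suc n) f g = trans (cong (f 0 + g 0 +_) (∑-+ n (f ∘ suc) (g ∘ suc)))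
  (interchange (f 0) (g 0) (∑ n (f ∘ suc)) (∑ n (g ∘ suc)))
  where
  interchange : ∀ a b c d → a + b + (c + d) ≡ a + c + (b + d)
  interchange = solve-∀

∑-*ˡ : ∀ n c f → ∑ n (λ i → c * f i) ≡ c * ∑ n f
∑-*ˡ zero    c f = sym (*-zeroʳ c)
∑-*ˡ (suc n) c f = trans (cong (c * f 0 +_) (∑-*ˡ n c (f ∘ suc))) (sym (*-distribˡ-+ c (f 0) _))

∑-swap : ∀ m n (f : ℕ → ℕ → ℕ) → ∑ m (λ i → ∑ n (f i)) ≡ ∑ n (λ j → ∑ m (λ i → f i j))
∑-swap zero    n f = sym (trans (∑-const n 0) (*-zeroʳ n))
∑-swap (suc m) n f = trans (cong (∑ n (f 0) +_) (∑-swap m n (f ∘ suc)))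
  (sym (∑-+ n (f 0) (λ j → ∑ m (λ i → f (suc i) j))))

∑-drop : ∀ m n f → ∑ n (f ∘ (m +_)) ≤ ∑ (m + n) f
∑-drop zero    n f = ≤-refl
∑-drop (suc m) n f = ≤-trans (∑-drop m n (f ∘ suc)) (m≤n+m _ (f 0))

∑-extend : ∀ m n f → ∑ n f ≤ ∑ (n + m) f
∑-extend m zero    f = z≤n
∑-extend m (suc n) f = +-monoʳ-≤ (f 0) (∑-extend m n (f ∘ suc))

∑-∸ : ∀ n d f → ∑ n f ∸ n * d ≤ ∑ n (λ i → f i ∸ d)
∑-∸ n d f = m≤n+o⇒m∸n≤o (∑ n f) (n * d) (begin
  ∑ n f                                  ≤⟨ ∑-mono-≤ n (λ i → m≤n+m∸n (f i) d) ⟩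
  ∑ n (λ i → d + (f i ∸ d))              ≡⟨ ∑-+ n (λ _ → d) _ ⟩
  ∑ n (λ _ → d) + ∑ n (λ i → f i ∸ d)    ≡⟨ cong (_+ ∑ n (λ i → f i ∸ d)) (∑-const n d) ⟩
  n * d + ∑ n (λ i → f i ∸ d)            ∎)
  where open ≤-Reasoning

-- The head is summed innermost: all one-entry extensions of a fixed tail are then grouped together,
-- as `distinct-tuples-step` requires.
∑ⱽ : ℕ → (k : ℕ) → (Vec ℕ k → ℕ) → ℕ
∑ⱽ u zero    f = f []
∑ⱽ u (suc k) f = ∑ⱽ u k (λ v → ∑ u (λ z → f (z ∷ v)))

∑ⱽ-mono-≤ : ∀ u k {f g} → (∀ v → f v ≤ g v) → ∑ⱽ u k f ≤ ∑ⱽ u k g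
∑ⱽ-mono-≤ u zero    le = le []
∑ⱽ-mono-≤ u (suc k) le = ∑ⱽ-mono-≤ u k (λ v → ∑-mono-≤ u (λ z → le (z ∷ v)))

∑ⱽ-cong : ∀ u k {f g} → (∀ v → f v ≡ g v) → ∑ⱽ u k f ≡ ∑ⱽ u k g
∑ⱽ-cong u k eq = ≤-antisym (∑ⱽ-mono-≤ u k (≤-reflexive ∘ eq)) (∑ⱽ-mono-≤ u k (≤-reflexive ∘ sym ∘ eq))

∑ⱽ-*ˡ : ∀ u k c f → ∑ⱽ u k (λ v → c * f v) ≡ c * ∑ⱽ u k f
∑ⱽ-*ˡ u zero    c f = refl
∑ⱽ-*ˡ u (suc k) c f = trans (∑ⱽ-cong u k (λ v → ∑-*ˡ u c (λ z → f (z ∷ v)))) (∑ⱽ-*ˡ u k c _)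

∑ⱽ-const : ∀ u k c → ∑ⱽ u k (λ _ → c) ≡ u ^ k * c
∑ⱽ-const u zero    c = sym (+-identityʳ c)
∑ⱽ-const u (suc k) c = begin
  ∑ⱽ u k (λ _ → ∑ u (λ _ → c))   ≡⟨ ∑ⱽ-const u k _ ⟩
  u ^ k * ∑ u (λ _ → c)          ≡⟨ cong (u ^ k *_) (∑-const u c) ⟩
  u ^ k * (u * c)                ≡⟨ rearrange (u ^ k) u c ⟩
  u * u ^ k * c                  ∎
  where
  open ≡-Reasoning
  rearrange : ∀ a b c → a * (b * c) ≡ b * a * c
  rearrange = solve-∀

∑-∑ⱽ-swap : ∀ T u k (f : ℕ → Vec ℕ k → ℕ) → ∑ T (λ t → ∑ⱽ u k (f t)) ≡ ∑ⱽ u k (λ v → ∑ T (λ t → f t v))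
∑-∑ⱽ-swap T u zero    f = refl
∑-∑ⱽ-swap T u (suc k) f = trans (∑-∑ⱽ-swap T u k _)
  (∑ⱽ-cong u k (λ v → ∑-swap T u (λ t z → f t (z ∷ v))))

-- Power means

-- The right side exceeds the left by (b - a)(q - p), which appears below as `c * e`.
rearrangement : ∀ {a b p q} → a ≤ b → p ≤ q → a * q + b * p ≤ a * p + b * q
rearrangement {a} {p = p} a≤b p≤q with m≤n⇒∃[o]m+o≡n a≤b | m≤n⇒∃[o]m+o≡n p≤q
... | c , refl | e , refl = ≤-trans (m≤m+n _ (c * e)) (≤-reflexive (identity a c p e))
  where
  identity : ∀ a c p e → a * (p + e) + (a + c) * p + c * e ≡ a * p + (a + c) * (p + e)
  identity = solve-∀

rearrangement-^ : ∀ k a b → a * b ^ k + b * a ^ k ≤ a * a ^ k + b * b ^ k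
rearrangement-^ k a b with ≤-total a b
... | inj₁ a≤b = rearrangement a≤b (^-monoˡ-≤ k a≤b)
... | inj₂ b≤a = subst₂ _≤_ (+-comm (b * a ^ k) _) (+-comm (b * b ^ k) _)
  (rearrangement b≤a (^-monoˡ-≤ k b≤a))

-- Chebyshev's sum inequality for the sequences `x i` and `x i ^ k`, which are ordered alike, so no
-- sorting is involved. Splitting off `x 0` leaves cross terms that pair it with each later entry,
-- and `rearrangement-^` bounds them one by one.
chebyshev : ∀ n k x → ∑ n x * ∑ n (λ i → x i ^ k) ≤ n * ∑ n (λ i → x i ^ suc k)
chebyshev zero    k x = z≤n
chebyshev (suc n) k x = begin
  (a + S₁) * (a ^ k + Sₖ)                        ≡⟨ expand a (a ^ k) S₁ Sₖ ⟩
  a * a ^ k + (a * Sₖ + a ^ k * S₁) + S₁ * Sₖ    ≤⟨ +-mono-≤ (+-monoʳ-≤ (a * a ^ k) cross) (chebyshev n k (x ∘ suc)) ⟩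
  a * a ^ k + (n * (a * a ^ k) + S) + n * S      ≡⟨ collect (a * a ^ k) n S ⟩
  suc n * (a * a ^ k + S)                        ∎
  where
  open ≤-Reasoning
  a  = x 0
  S₁ = ∑ n (x ∘ suc)
  Sₖ = ∑ n (λ i → x (suc i) ^ k)
  S  = ∑ n (λ i → x (suc i) ^ suc k)
  expand : ∀ a b c d → (a + c) * (b + d) ≡ a * b + (a * d + b * c) + c * d
  expand = solve-∀
  collect : ∀ p n s → p + (n * p + s) + n * s ≡ (1 + n) * (p + s)
  collect = solve-∀
  cross : a * Sₖ + a ^ k * S₁ ≤ n * (a * a ^ k) + S
  cross = begin
    a * Sₖ + a ^ k * S₁
      ≡⟨ cong₂ _+_ (∑-*ˡ n a _) (∑-*ˡ n (a ^ k) _) ⟨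
    ∑ n (λ i → a * x (suc i) ^ k) + ∑ n (λ i → a ^ k * x (suc i))
      ≡⟨ ∑-+ n _ _ ⟨
    ∑ n (λ i → a * x (suc i) ^ k + a ^ k * x (suc i))
      ≤⟨ ∑-mono-≤ n (λ i → ≤-trans (≤-reflexive (cong (a * x (suc i) ^ k +_) (*-comm (a ^ k) (x (suc i)))))
                           (rearrangement-^ k a (x (suc i)))) ⟩
    ∑ n (λ i → a * a ^ k + x (suc i) ^ suc k)
      ≡⟨ ∑-+ n _ _ ⟩
    ∑ n (λ _ → a * a ^ k) + S
      ≡⟨ cong (_+ S) (∑-const n _) ⟩
    n * (a * a ^ k) + S ∎

-- Induction on the exponent: `chebyshev` absorbs one more factor `∑ n x` into the power sum at the
-- price of a factor `n`.
power-mean : ∀ n d x → ∑ n x ^ suc d ≤ n ^ d * ∑ n (λ i → x i ^ suc d)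
power-mean n zero    x = ≤-trans (≤-reflexive (*-identityʳ (∑ n x)))
  (≤-trans (∑-mono-≤ n (λ i → ≤-reflexive (sym (*-identityʳ (x i))))) (≤-reflexive (sym (+-identityʳ _))))
power-mean n (suc d) x = begin
  ∑ n x * ∑ n x ^ suc d                               ≤⟨ *-monoʳ-≤ (∑ n x) (power-mean n d x) ⟩
  ∑ n x * (n ^ d * ∑ n (λ i → x i ^ suc d))           ≡⟨ left-comm (∑ n x) (n ^ d) _ ⟩
  n ^ d * (∑ n x * ∑ n (λ i → x i ^ suc d))           ≤⟨ *-monoʳ-≤ (n ^ d) (chebyshev n (suc d) x) ⟩
  n ^ d * (n * ∑ n (λ i → x i ^ suc (suc d)))         ≡⟨ regroup (n ^ d) n _ ⟩
  n * n ^ d * ∑ n (λ i → x i ^ suc (suc d))           ∎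
  where
  open ≤-Reasoning
  left-comm : ∀ a b c → a * (b * c) ≡ b * (a * c)
  left-comm = solve-∀
  regroup : ∀ a b c → a * (b * c) ≡ b * a * c
  regroup = solve-∀

-- Tuples of distinct elements

𝟙 : Bool → ℕ
𝟙 b = if b then 1 else 0

_∈ᵇ_ : ∀ {k} → ℕ → Vec ℕ k → Bool
z ∈ᵇ []      = false
z ∈ᵇ (y ∷ v) = if z ≡ᵇ y then true else z ∈ᵇ v

distinctIn : ∀ {k} → (ℕ → Bool) → Vec ℕ k → Bool
distinctIn χ []      = true
distinctIn χ (z ∷ v) = (χ z ∧ not (z ∈ᵇ v)) ∧ distinctIn χ v

∑-𝟙-≡ᵇ-≤1 : ∀ u y → ∑ u (λ z → 𝟙 (z ≡ᵇ y)) ≤ 1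
∑-𝟙-≡ᵇ-≤1 zero    y       = z≤n
∑-𝟙-≡ᵇ-≤1 (suc u) zero    = ≤-reflexive (cong suc (trans (∑-const u 0) (*-zeroʳ u)))
∑-𝟙-≡ᵇ-≤1 (suc u) (suc y) = ∑-𝟙-≡ᵇ-≤1 u y

-- Each entry of `v` rules out at most one `z`, whether or not the entries are distinct.
count-avoiding : ∀ {k} u χ (v : Vec ℕ k) → ∑ u (𝟙 ∘ χ) ≤ k + ∑ u (λ z → 𝟙 (χ z ∧ not (z ∈ᵇ v)))
count-avoiding u χ []      = ∑-mono-≤ u λ z → ≤-reflexive (cong 𝟙 (sym (∧-identityʳ (χ z))))
count-avoiding {suc k} u χ (y ∷ v) = begin
  ∑ u (𝟙 ∘ χ)                                                       ≤⟨ count-avoiding u χ v ⟩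
  k + ∑ u (λ z → 𝟙 (χ z ∧ not (z ∈ᵇ v)))                            ≤⟨ +-monoʳ-≤ k (∑-mono-≤ u λ z → pointwise (χ z) (z ≡ᵇ y) (z ∈ᵇ v)) ⟩
  k + ∑ u (λ z → 𝟙 (z ≡ᵇ y) + 𝟙 (χ z ∧ not (z ∈ᵇ (y ∷ v))))         ≡⟨ cong (k +_) (∑-+ u _ _) ⟩
  k + (∑ u (λ z → 𝟙 (z ≡ᵇ y)) + R)                                  ≤⟨ +-monoʳ-≤ k (+-monoˡ-≤ R (∑-𝟙-≡ᵇ-≤1 u y)) ⟩
  k + suc R                                                         ≡⟨ +-suc k R ⟩
  suc k + R                                                         ∎
  where
  open ≤-Reasoning
  R = ∑ u (λ z → 𝟙 (χ z ∧ not (z ∈ᵇ (y ∷ v))))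
  pointwise : ∀ a b c → 𝟙 (a ∧ not c) ≤ 𝟙 b + 𝟙 (a ∧ not (if b then true else c))
  pointwise false b     c     = z≤n
  pointwise true  false c     = ≤-refl
  pointwise true  true  false = s≤s z≤n
  pointwise true  true  true  = z≤n

-- A tuple of `k` distinct elements can be extended by any element that it avoids, and
-- `count-avoiding` leaves enough of these. Other tuples contribute 0 on the left.
distinct-tuples-step : ∀ u χ k →
  (∑ u (𝟙 ∘ χ) ∸ k) * ∑ⱽ u k (𝟙 ∘ distinctIn χ) ≤ ∑ⱽ u (suc k) (𝟙 ∘ distinctIn χ)
distinct-tuples-step u χ k = ≤-trans (≤-reflexive (sym (∑ⱽ-*ˡ u k a _))) (∑ⱽ-mono-≤ u k extend)
  where
  a = ∑ u (𝟙 ∘ χ) ∸ k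
  extend : ∀ v → a * 𝟙 (distinctIn χ v) ≤ ∑ u (λ z → 𝟙 (distinctIn χ (z ∷ v)))
  extend v with distinctIn χ v
  ... | false = ≤-trans (≤-reflexive (*-zeroʳ a)) z≤n
  ... | true  = ≤-trans (≤-reflexive (*-identityʳ a))
    (≤-trans (m≤n+o⇒m∸n≤o (∑ u (𝟙 ∘ χ)) k (count-avoiding u χ v)) (∑-mono-≤ u λ z → ≤-reflexive (cong 𝟙 (sym (∧-identityʳ _)))))

-- With a elements in the window, the step lemma yields the falling factorial a (a - 1) ... (a - k +
-- 1). Its `k` factors subtract at most `d`, so each is at least `a ∸ d`; truncation covers small a.
distinct-tuples : ∀ u χ d k → k ≤ suc d → (∑ u (𝟙 ∘ χ) ∸ d) ^ k ≤ ∑ⱽ u k (𝟙 ∘ distinctIn χ)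
distinct-tuples u χ d zero    _         = ≤-refl
distinct-tuples u χ d (suc k) (s≤s k≤d) = ≤-trans
  (*-mono-≤ (∸-monoʳ-≤ (∑ u (𝟙 ∘ χ)) k≤d) (distinct-tuples u χ d k (m≤n⇒m≤1+n k≤d)))
  (distinct-tuples-step u χ k)

∧-≡true : ∀ {a b} → a ∧ b ≡ true → a ≡ true × b ≡ true
∧-≡true {true} eq = refl , eq

∉ᵇ-lookup : ∀ {k} z (v : Vec ℕ k) i → z ∈ᵇ v ≡ false → z ≢ lookup v i
∉ᵇ-lookup z (y ∷ v) zero    z∉ e with z ≡ᵇ y in eq
... | false = subst T eq (≡⇒≡ᵇ z y e)
∉ᵇ-lookup z (y ∷ v) (suc i) z∉ e with z ≡ᵇ y
... | false = ∉ᵇ-lookup z v i z∉ e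

not-≡true : ∀ {b} → not b ≡ true → b ≡ false
not-≡true {false} _ = refl

distinctIn-injective : ∀ {k} χ (v : Vec ℕ k) → distinctIn χ v ≡ true → Injective _≡_ _≡_ (lookup v)
distinctIn-injective χ (z ∷ v) eq {i} {j} with ∧-≡true eq
... | head , tail with ∧-≡true head
... | _ , z∉ = go i j
  where
  go : ∀ i j → lookup (z ∷ v) i ≡ lookup (z ∷ v) j → i ≡ j
  go zero    zero    _ = refl
  go zero    (suc j) e = contradiction e (∉ᵇ-lookup z v j (not-≡true z∉))
  go (suc i) zero    e = contradiction (sym e) (∉ᵇ-lookup z v i (not-≡true z∉))
  go (suc i) (suc j) e = cong suc (distinctIn-injective χ v tail e)

distinctIn-lookup : ∀ {k} χ (v : Vec ℕ k) → distinctIn χ v ≡ true → ∀ i → χ (lookup v i) ≡ true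
distinctIn-lookup χ (z ∷ v) eq i with ∧-≡true eq
... | head , tail with ∧-≡true head | i
... | χz , _ | zero  = χz
... | _      | suc i = distinctIn-lookup χ v tail i

-- Turns a numerical count into the injective family of shifts that `IsC` speaks of.
enumerate : ∀ T (χ : ℕ → Bool) g → g ≤ ∑ T (𝟙 ∘ χ) →
            Σ (Fin g → ℕ) λ k → Injective _≡_ _≡_ k × (∀ i → χ (k i) ≡ true)
enumerate zero    χ zero    _ = (λ ()) , (λ { {()} }) , λ ()
enumerate (suc T) χ zero    _ = (λ ()) , (λ { {()} }) , λ ()
enumerate (suc T) χ (suc g) le with χ 0 in eq
... | false = let k , inj , k∈ = enumerate T (χ ∘ suc) (suc g) le
              in suc ∘ k , inj ∘ suc-injective , k∈
... | true  = let k , inj , k∈ = enumerate T (χ ∘ suc) g (s≤s⁻¹ le)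
              in cons k , cons-injective k inj , λ { zero → eq ; (suc i) → k∈ i }
  where
  cons : (Fin g → ℕ) → Fin (suc g) → ℕ
  cons k zero    = 0
  cons k (suc i) = suc (k i)
  cons-injective : ∀ k → Injective _≡_ _≡_ k → Injective _≡_ _≡_ (cons k)
  cons-injective k inj {zero}  {zero}  _ = refl
  cons-injective k inj {suc i} {suc j} e = cong suc (inj (suc-injective e))

-- Counting in windows

-- Total on ℕ, with `false` past the end, so that windows may overhang the set on the right.
_∋_ : ∀ {n} → Subset n → ℕ → Bool
[]      ∋ _     = false
(s ∷ A) ∋ zero  = s
(s ∷ A) ∋ suc i = A ∋ i

∣A∣≡∑ : ∀ {n} (A : Subset n) → ∣ A ∣ ≡ ∑ n (𝟙 ∘ (A ∋_))
∣A∣≡∑ []          = refl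
∣A∣≡∑ (true ∷ A)  = cong suc (∣A∣≡∑ A)
∣A∣≡∑ (false ∷ A) = ∣A∣≡∑ A

∋-Fin : ∀ {n} (A : Subset n) x → A ∋ x ≡ true → Σ (Fin n) λ i → (i ∈ˢ A) × x ≡ toℕ i
∋-Fin (true ∷ A) zero    _  = zero , here , refl
∋-Fin (s ∷ A)    (suc x) eq = let i , i∈A , e = ∋-Fin A x eq in suc i , there i∈A , cong suc e

-- A translated by u, so that all windows start at a natural number.
pad : ∀ {n} u → Subset n → Subset (u + n)
pad u A = replicate u outside ++ A

pad-∋ : ∀ {n} u (A : Subset n) x → pad u A ∋ (u + x) ≡ A ∋ x
pad-∋ zero    A x = refl
pad-∋ (suc u) A x = pad-∋ u A x

∋-pad : ∀ {n} u (A : Subset n) y → pad u A ∋ y ≡ true → ∃ λ x → y ≡ u + x × A ∋ x ≡ true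
∋-pad zero    A y       eq = y , refl , eq
∋-pad (suc u) A (suc y) eq = let x , e , x∈ = ∋-pad u A y eq in x , cong suc e , x∈

window : ∀ {n} u → Subset n → ℕ → ℕ → Bool
window u A t z = pad u A ∋ (z + t)

-- After exchanging the sums it suffices to fix an offset `z < u`: as the window slides, offset `z`
-- passes over every element of `A`.
window-total : ∀ {n} u (A : Subset n) → u * ∣ A ∣ ≤ ∑ (u + n) (λ t → ∑ u (𝟙 ∘ window u A t))
window-total {n} u A = begin
  u * ∣ A ∣                                               ≡⟨ ∑-const u ∣ A ∣ ⟨
  ∑ u (λ _ → ∣ A ∣)                                       ≤⟨ ∑-mono-≤-< u (λ z z<u → column z (<⇒≤ z<u)) ⟩
  ∑ u (λ z → ∑ (u + n) (λ t → 𝟙 (window u A t z)))        ≡⟨ ∑-swap (u + n) u (λ t z → 𝟙 (window u A t z)) ⟨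
  ∑ (u + n) (λ t → ∑ u (𝟙 ∘ window u A t))                ∎
  where
  open ≤-Reasoning
  column : ∀ z → z ≤ u → ∣ A ∣ ≤ ∑ (u + n) (λ t → 𝟙 (window u A t z))
  -- With `u = z + c`, element `x` sits at `u + x` in the padded set and is seen at offset `z` from
  -- position `c + x`. The first `c` and the last `z` positions are discarded.
  column z z≤u with m≤n⇒∃[o]m+o≡n z≤u
  ... | c , refl = begin
    ∣ A ∣                                            ≡⟨ ∣A∣≡∑ A ⟩
    ∑ n (𝟙 ∘ (A ∋_))                                 ≤⟨ ∑-mono-≤ n (λ x → ≤-reflexive (cong 𝟙 (sym (at x)))) ⟩
    ∑ n (λ x → 𝟙 (window (z + c) A (c + x) z))       ≤⟨ ∑-drop c n _ ⟩
    ∑ (c + n) (λ t → 𝟙 (window (z + c) A t z))       ≤⟨ ∑-extend z (c + n) _ ⟩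
    ∑ (c + n + z) (λ t → 𝟙 (window (z + c) A t z))   ≡⟨ cong (λ T → ∑ T (λ t → 𝟙 (window (z + c) A t z))) (rotate c n z) ⟩
    ∑ (z + c + n) (λ t → 𝟙 (window (z + c) A t z))   ∎
    where
    rotate : ∀ c n z → c + n + z ≡ z + c + n
    rotate = solve-∀
    at : ∀ x → window (z + c) A (c + x) z ≡ A ∋ x
    at x = trans (cong (pad (z + c) A ∋_) (sym (+-assoc z c x))) (pad-∋ (z + c) A x)

translates-bounded : ∀ {n} u G h (A : Subset n) → IsC h (suc G) ⟦ A ⟧ → ∀ T (v : Vec ℕ h) →
                     ∑ T (λ t → 𝟙 (distinctIn (window u A t) v)) ≤ G
translates-bounded u G h A isC T v = ≮⇒≥ λ G<∑ →
  let k , k-inj , k∈ = enumerate T (λ t → distinctIn (window u A t) v) (suc G) G<∑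
  in isC (λ j → pos (lookup v j))
       -- A tuple with a repeated entry is counted at no position, so distinctness of `v` can be
       -- read off at any counted one; `k zero` is at hand.
       (λ e → distinctIn-injective (window u A (k zero)) v (k∈ zero) (ℤₚ.+-injective e))
       ( (λ i → suc (k i) ⊖ u)
       -- The shift `suc (k i) ⊖ u` undoes the padding by `u`; the `suc` accounts for index i
       -- standing for the integer i + 1.
       , (λ {i} {j} e → k-inj (suc-injective (⊖-injective u e)))
       , λ i j → inA (lookup v j) (k i) (distinctIn-lookup (window u A (k i)) v (k∈ i) j))
  where
  ⊖-injective : ∀ u {a b} → a ⊖ u ≡ b ⊖ u → a ≡ b
  ⊖-injective u {a} {b} e = ℤₚ.+-injective (∙-cancelʳ (ℤ.- pos u) (pos a) (pos b)
    (trans (ℤₚ.m-n≡m⊖n a u) (trans e (sym (ℤₚ.m-n≡m⊖n b u)))))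
  inA : ∀ z t → window u A t z ≡ true → ⟦ A ⟧ (pos z ℤ.+ (suc t ⊖ u))
  inA z t eq with ∋-pad u A (z + t) eq
  ... | x , z+t≡u+x , x∈A with ∋-Fin A x x∈A
  ... | i , i∈A , refl = i , i∈A , (begin
    pos z ℤ.+ (suc t ⊖ u)      ≡⟨ ℤₚ.distribʳ-⊖-+-pos z (suc t) u ⟩
    (z + suc t) ⊖ u            ≡⟨ cong (_⊖ u) (trans (+-suc z t) (trans (cong suc z+t≡u+x) (sym (+-suc u (toℕ i))))) ⟩
    (u + suc (toℕ i)) ⊖ u      ≡⟨ ℤₚ.⊖-≥ (m≤m+n u _) ⟩
    pos (u + suc (toℕ i) ∸ u)  ≡⟨ cong pos (m+n∸m≡n u _) ⟩
    pos (suc (toℕ i))            ∎)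
    where open ≡-Reasoning

-- Here `d` is h - 1 and `G` is g - 1. Truncated subtraction lets windows with fewer than h elements
-- contribute 0, while the sum of the `a t ∸ d` still dominates `u * ∣ A ∣ ∸ (u + n) * d`.
window-inequality : ∀ {n} d G u (A : Subset n) → IsC (suc d) (suc G) ⟦ A ⟧ →
  (u * ∣ A ∣ ∸ (u + n) * d) ^ suc d ≤ (u + n) ^ d * (u ^ suc d * G)
window-inequality {n} d G u A isC = begin
  (u * ∣ A ∣ ∸ L * d) ^ suc d                    ≤⟨ ^-monoˡ-≤ (suc d) (≤-trans (∸-monoˡ-≤ (L * d) (window-total u A)) (∑-∸ L d a)) ⟩
  ∑ L (λ t → a t ∸ d) ^ suc d                    ≤⟨ power-mean L d _ ⟩
  L ^ d * ∑ L (λ t → (a t ∸ d) ^ suc d)          ≤⟨ *-monoʳ-≤ (L ^ d) (∑-mono-≤ L λ t → distinct-tuples u (window u A t) d (suc d) ≤-refl) ⟩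
  L ^ d * ∑ L (λ t → ∑ⱽ u (suc d) (λ v → 𝟙 (distinctIn (window u A t) v)))
    ≡⟨ cong (L ^ d *_) (∑-∑ⱽ-swap L u (suc d) (λ t v → 𝟙 (distinctIn (window u A t) v))) ⟩
  L ^ d * ∑ⱽ u (suc d) (λ v → ∑ L (λ t → 𝟙 (distinctIn (window u A t) v)))
    ≤⟨ *-monoʳ-≤ (L ^ d) (∑ⱽ-mono-≤ u (suc d) (translates-bounded u G (suc d) A isC L)) ⟩
  L ^ d * ∑ⱽ u (suc d) (λ _ → G)                 ≡⟨ cong (L ^ d *_) (∑ⱽ-const u (suc d) G) ⟩
  L ^ d * (u ^ suc d * G)                        ∎
  where
  open ≤-Reasoning
  L = u + n
  a : ℕ → ℕ
  a t = ∑ u (𝟙 ∘ window u A t)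

-- Estimates for integer roots

^-cancelˡ-≤ : ∀ k {a b} → a ^ suc k ≤ b ^ suc k → a ≤ b
^-cancelˡ-≤ k le = ≮⇒≥ λ b<a → <⇒≱ (^-monoˡ-< (suc k) b<a) le

^-double : ∀ x k → x ^ (2 * k) ≡ x ^ k * x ^ k
^-double x k = trans (cong (λ j → x ^ (k + j)) (+-identityʳ k)) (^-distribˡ-+-* x k k)

iroot-upper-≤ : ∀ k N → N ≤ suc (iroot (suc k) N) ^ suc k
iroot-upper-≤ k N = <⇒≤ (iroot-upper k N)

≤-iroot : ∀ k {N a} → a ^ suc k ≤ N → a ≤ iroot (suc k) N
≤-iroot k {N} le = s≤s⁻¹ (^-cancelˡ-< (suc k) (≤-<-trans le (iroot-upper k N)))

iroot-≤ : ∀ k {N b} → N ≤ b ^ suc k → iroot (suc k) N ≤ b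
iroot-≤ k {N} le = ^-cancelˡ-≤ k (≤-trans (iroot-lower k N) le)

suc≤2* : ∀ {a} → 1 ≤ a → suc a ≤ 2 * a
suc≤2* {a} 1≤a = ≤-trans (+-monoˡ-≤ a 1≤a) (≤-reflexive (cong (a +_) (sym (+-identityʳ a))))

-- R₁ / s, R₂ / s, R₃ / s play (g - 1)^(1/h), n^(1 - 1/h), n^(1/2 - 1/2h).
cleared-bound : ∀ G d n s u M R₁ R₂ R₃ → 1 ≤ n → 1 ≤ u → n ≤ s → s ≤ R₃ → R₁ ≤ G * s → R₂ ≤ n * s →
  n * s ≤ 2 * u * R₃ → suc R₂ * u ≤ 8 * n * R₃ →
  n * (s * s) * (u * M ∸ (u + n) * d) ≤ suc R₁ * suc R₂ * u * (u + n) →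
  s * s * M ≤ R₁ * R₂ + (9 * G + 10 + 3 * d) * (s * R₃)
cleared-bound G d n s u M R₁ R₂ R₃ 1≤n 1≤u n≤s s≤R₃ R₁≤ R₂≤ ns≤ P₂u≤ main =
  *-cancelˡ-≤ (n * u) {{m*n≢0 n u {{>-nonZero 1≤n}} {{>-nonZero 1≤u}}}} (begin
  n * u * (s * s * M)
    ≡⟨ e₁ n u s M ⟩
  n * (s * s) * (u * M)
    ≤⟨ *-monoʳ-≤ (n * (s * s)) (m≤n+m∸n (u * M) ((u + n) * d)) ⟩
  n * (s * s) * ((u + n) * d + X)
    ≡⟨ e₂ n s u d X ⟩
  d * (n * u * s) * s + d * (n * s) * (n * s) + n * (s * s) * X
    ≤⟨ +-mono-≤ (+-mono-≤ (*-monoʳ-≤ (d * (n * u * s)) s≤R₃) (*-monoʳ-≤ (d * (n * s)) ns≤)) main ⟩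
  d * (n * u * s) * R₃ + d * (n * s) * (2 * u * R₃) + suc R₁ * suc R₂ * u * (u + n)
    -- The factor `u + n` is split. Its `n` part gives the main term `R₁ * R₂` and the rounding
    -- error `R₁ + R₂ + 1`; its `u` part is the cost of the windows overhanging the interval.
    ≡⟨ e₃ d n u s R₁ R₂ R₃ ⟩
  n * u * (R₁ * R₂ + 3 * d * (s * R₃)) + (n * u * (R₁ + R₂ + 1) + suc R₁ * u * (suc R₂ * u))
    ≤⟨ +-monoʳ-≤ (n * u * (R₁ * R₂ + 3 * d * (s * R₃)))
         (+-mono-≤ (*-monoʳ-≤ (n * u) small) (*-mono-≤ (*-monoˡ-≤ u P₁≤) P₂u≤)) ⟩
  n * u * (R₁ * R₂ + 3 * d * (s * R₃)) + (n * u * ((G + 2) * (s * R₃)) + (G * s + s) * u * (8 * n * R₃))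
    -- The constant is `G + 2` from rounding, `8 * (G + 1)` from the overhang, and `3 * d` from the
    -- subtracted `(u + n) * d`.
    ≡⟨ e₄ G d n u s R₁ R₂ R₃ ⟩
  n * u * (R₁ * R₂ + (9 * G + 10 + 3 * d) * (s * R₃)) ∎)
  where
  open ≤-Reasoning
  X = u * M ∸ (u + n) * d
  1≤s : 1 ≤ s
  1≤s = ≤-trans 1≤n n≤s
  1≤R₃ : 1 ≤ R₃
  1≤R₃ = ≤-trans 1≤s s≤R₃
  P₁≤ : suc R₁ ≤ G * s + s
  P₁≤ = ≤-trans (≤-reflexive (+-comm 1 R₁)) (+-mono-≤ R₁≤ 1≤s)
  small : R₁ + R₂ + 1 ≤ (G + 2) * (s * R₃)
  small = begin
    R₁ + R₂ + 1                          ≤⟨ +-mono-≤ (+-mono-≤ R₁≤ R₂≤) (*-mono-≤ 1≤s 1≤R₃) ⟩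
    G * s + n * s + s * R₃               ≤⟨ +-monoˡ-≤ (s * R₃) (+-mono-≤
      (*-monoʳ-≤ G (≤-trans (≤-reflexive (sym (*-identityʳ s))) (*-monoʳ-≤ s 1≤R₃)))
      (≤-trans (≤-reflexive (*-comm n s)) (*-monoʳ-≤ s (≤-trans n≤s s≤R₃)))) ⟩
    G * (s * R₃) + s * R₃ + s * R₃       ≡⟨ e₅ G (s * R₃) ⟩
    (G + 2) * (s * R₃)                   ∎
    where
    e₅ : ∀ G x → G * x + x + x ≡ (G + 2) * x
    e₅ = solve-∀
  e₁ : ∀ n u s M → n * u * (s * s * M) ≡ n * (s * s) * (u * M)
  e₁ = solve-∀
  e₂ : ∀ n s u d X → n * (s * s) * ((u + n) * d + X) ≡ d * (n * u * s) * s + d * (n * s) * (n * s) + n * (s * s) * X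
  e₂ = solve-∀
  e₃ : ∀ d n u s a b c → d * (n * u * s) * c + d * (n * s) * (2 * u * c) + (1 + a) * (1 + b) * u * (u + n)
     ≡ n * u * (a * b + 3 * d * (s * c)) + (n * u * (a + b + 1) + (1 + a) * u * ((1 + b) * u))
  e₃ = solve-∀
  e₄ : ∀ G d n u s a b c → n * u * (a * b + 3 * d * (s * c)) + (n * u * ((G + 2) * (s * c)) + (G * s + s) * u * (8 * n * c))
     ≡ n * u * (a * b + (9 * G + 10 + 3 * d) * (s * c))
  e₄ = solve-∀

-- The roots are known only through floors at scale `s`, so fractional powers are compared by
-- raising to the power h or 2h. The condition `n ≤ s` lets the last term absorb the rounding
-- errors: `R₂ ≤ n * s ≤ s * R₃`.
root-bound : ∀ {n} G d (A : Subset n) → 1 ≤ G → 1 ≤ n → IsC (suc d) (suc G) ⟦ A ⟧ → ∀ s → n ≤ s →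
  s * s * ∣ A ∣ ≤ iroot (suc d) (G ^ 1 * s ^ suc d) * iroot (suc d) (n ^ d * s ^ suc d)
                + (9 * G + 10 + 3 * d) * (s * iroot (2 * suc d) (n ^ d * s ^ (2 * suc d)))
root-bound {n} G d A 1≤G 1≤n isC s n≤s =
  cleared-bound G d n s u ∣ A ∣ R₁ R₂ R₃ 1≤n (s≤s z≤n) n≤s s≤R₃ R₁≤ R₂≤ ns≤ P₂u≤ main
  where
  open ≤-Reasoning
  H = suc d
  -- `K` unfolds definitionally to `suc k`, the shape that the `iroot` lemmas take.
  k = d + (H + 0)
  K = 2 * H
  a = n ^ d
  b = s ^ H
  v = iroot K (n ^ suc H)
  -- The length n^(1/2 + 1/2h) balances the two error terms u n^(-1/h) and n / u.
  u = suc v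
  R₁ = iroot H (G ^ 1 * s ^ H)
  R₂ = iroot H (n ^ d * s ^ H)
  R₃ = iroot K (n ^ d * s ^ K)
  instance
    n≢0 : NonZero n
    n≢0 = >-nonZero 1≤n
    G≢0 : NonZero G
    G≢0 = >-nonZero 1≤G
    a≢0 : NonZero a
    a≢0 = m^n≢0 n d
  1≤s : 1 ≤ s
  1≤s = ≤-trans 1≤n n≤s
  s≤R₃ : s ≤ R₃
  s≤R₃ = ≤-iroot k (m≤n*m (s ^ K) a)
  s≤R₂ : s ≤ R₂
  s≤R₂ = ≤-iroot d (m≤n*m b a)
  1≤v : 1 ≤ v
  1≤v = ≤-iroot k (≤-trans (≤-reflexive (^-zeroˡ K)) (m^n>0 n (suc H)))
  P₃≤ : suc R₃ ≤ 2 * R₃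
  P₃≤ = suc≤2* (≤-trans 1≤s s≤R₃)
  R₁≤ : R₁ ≤ G * s
  R₁≤ = iroot-≤ d (≤-trans (*-monoˡ-≤ b (^-monoʳ-≤ G (s≤s (z≤n {d})))) (≤-reflexive (sym (^-distribʳ-* G s H))))
  R₂≤ : R₂ ≤ n * s
  R₂≤ = iroot-≤ d (≤-trans (*-monoˡ-≤ b (^-monoʳ-≤ n (n≤1+n d))) (≤-reflexive (sym (^-distribʳ-* n s H))))
  -- This is n / u ≤ 2 n^(1/2 - 1/2h). In K-th powers the exponents match because `suc H + d` equals
  -- `K`; `u = suc v` is needed to have `n ^ suc H ≤ u ^ K`.
  ns≤ : n * s ≤ 2 * u * R₃
  ns≤ = ≤-trans (^-cancelˡ-≤ k (begin
    (n * s) ^ K                      ≡⟨ ^-distribʳ-* n s K ⟩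
    n ^ K * s ^ K                    ≡⟨ cong (_* s ^ K) (^-double n H) ⟩
    n * a * (n * a) * s ^ K          ≡⟨ e n a (s ^ K) ⟩
    n * (n * a) * (a * s ^ K)        ≤⟨ *-mono-≤ (iroot-upper-≤ k (n ^ suc H)) (iroot-upper-≤ k (a * s ^ K)) ⟩
    u ^ K * suc R₃ ^ K               ≡⟨ ^-distribʳ-* u (suc R₃) K ⟨
    (u * suc R₃) ^ K                 ∎))
    (≤-trans (*-monoʳ-≤ u P₃≤) (≤-reflexive (e′ u R₃)))
    where
    e : ∀ n a c → n * a * (n * a) * c ≡ n * (n * a) * (a * c)
    e = solve-∀
    e′ : ∀ u r → u * (2 * r) ≡ 2 * u * r
    e′ = solve-∀
  -- Up to rounding, both sides are s n^(3/2 - 1/2h). The rounded-down `v` is used because it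
  -- satisfies `v ^ K ≤ n ^ suc H`.
  R₂v≤ : R₂ * v ≤ n * suc R₃
  R₂v≤ = ^-cancelˡ-≤ k (begin
    (R₂ * v) ^ K                     ≡⟨ ^-distribʳ-* R₂ v K ⟩
    R₂ ^ K * v ^ K                   ≡⟨ cong (_* v ^ K) (^-double R₂ H) ⟩
    R₂ ^ H * R₂ ^ H * v ^ K          ≤⟨ *-mono-≤ (*-mono-≤ (iroot-lower d (a * b)) (iroot-lower d (a * b))) (iroot-lower k (n ^ suc H)) ⟩
    a * b * (a * b) * (n * (n * a))  ≡⟨ e n a b ⟩
    n * a * (n * a) * (a * (b * b))  ≡⟨ cong₂ (λ x y → x * (a * y)) (^-double n H) (^-double s H) ⟨
    n ^ K * (a * s ^ K)              ≤⟨ *-monoʳ-≤ (n ^ K) (iroot-upper-≤ k (a * s ^ K)) ⟩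
    n ^ K * suc R₃ ^ K               ≡⟨ ^-distribʳ-* n (suc R₃) K ⟨
    (n * suc R₃) ^ K                 ∎)
    where
    e : ∀ n a b → a * b * (a * b) * (n * (n * a)) ≡ n * a * (n * a) * (a * (b * b))
    e = solve-∀
  -- The 8 is three factors of 2, from replacing `suc R₂`, `suc v` and `suc R₃` by twice `R₂`, `v`
  -- and `R₃`.
  P₂u≤ : suc R₂ * u ≤ 8 * n * R₃
  P₂u≤ = begin
    suc R₂ * u             ≤⟨ *-mono-≤ (suc≤2* (≤-trans 1≤s s≤R₂)) (suc≤2* 1≤v) ⟩
    2 * R₂ * (2 * v)       ≡⟨ e R₂ v ⟩
    4 * (R₂ * v)           ≤⟨ *-monoʳ-≤ 4 (≤-trans R₂v≤ (*-monoʳ-≤ n P₃≤)) ⟩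
    4 * (n * (2 * R₃))     ≡⟨ e′ n R₃ ⟩
    8 * n * R₃             ∎
    where
    e : ∀ r v → 2 * r * (2 * v) ≡ 4 * (r * v)
    e = solve-∀
    e′ : ∀ n r → 4 * (n * (2 * r)) ≡ 8 * n * r
    e′ = solve-∀
  X = u * ∣ A ∣ ∸ (u + n) * d
  P₁ = suc R₁
  P₂ = suc R₂
  -- Uses (u + n)^(d/h) ≤ n^(d/h) (u + n) / n, which follows from n ≤ u + n.
  main : n * (s * s) * X ≤ P₁ * P₂ * u * (u + n)
  main = ^-cancelˡ-≤ d (begin
    (n * (s * s) * X) ^ H                                    ≡⟨ ^-distribʳ-* (n * (s * s)) X H ⟩
    (n * (s * s)) ^ H * X ^ H                                ≡⟨ cong (_* X ^ H) (trans (^-distribʳ-* n (s * s) H) (cong (n ^ H *_) (^-distribʳ-* s s H))) ⟩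
    n * a * (b * b) * X ^ H                                  ≤⟨ *-monoʳ-≤ (n * a * (b * b)) (window-inequality d G u A isC) ⟩
    n * a * (b * b) * ((u + n) ^ d * (u ^ H * G))            ≡⟨ e n a b ((u + n) ^ d) (u ^ H) G ⟩
    G * 1 * b * (a * b) * u ^ H * (n * (u + n) ^ d)          ≤⟨ *-mono-≤ (*-monoˡ-≤ (u ^ H) (*-mono-≤ (iroot-upper-≤ d (G ^ 1 * b)) (iroot-upper-≤ d (a * b))))
                                                                 (*-monoˡ-≤ ((u + n) ^ d) (m≤n+m n u)) ⟩
    P₁ ^ H * P₂ ^ H * u ^ H * (u + n) ^ H                    ≡⟨ cong (λ x → x * u ^ H * (u + n) ^ H) (^-distribʳ-* P₁ P₂ H) ⟨
    (P₁ * P₂) ^ H * u ^ H * (u + n) ^ H                      ≡⟨ cong (_* (u + n) ^ H) (^-distribʳ-* (P₁ * P₂) u H) ⟨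
    (P₁ * P₂ * u) ^ H * (u + n) ^ H                          ≡⟨ ^-distribʳ-* (P₁ * P₂ * u) (u + n) H ⟨
    (P₁ * P₂ * u * (u + n)) ^ H                              ∎)
    where
    e : ∀ n a b t w G → n * a * (b * b) * (t * (w * G)) ≡ G * 1 * b * (a * b) * w * (n * t)
    e = solve-∀

-- From integer inequalities to real numbers

/-bound : ∀ M a b C c m → suc m * suc m * M ≤ a * b + C * (suc m * c) →
  pos M ℚ./ 1 ℚ.≤ (pos a ℚ./ suc m) ℚ.* (pos b ℚ./ suc m) ℚ.+ (pos C ℚ./ 1) ℚ.* (pos c ℚ./ suc m)
/-bound M a b C c m le = ℚₚ.toℚᵘ-cancel-≤ (ℚᵘₚ.≤-trans (ℚᵘₚ.≤-reflexive (toℚᵘ-/ M 0))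
  (ℚᵘₚ.≤-trans (ℚᵘ.*≤* cross) (ℚᵘₚ.≤-reflexive (ℚᵘₚ.≃-sym rhs))))
  where
  s = suc m
  a′ = ℚᵘ.mkℚᵘ (pos a) m
  b′ = ℚᵘ.mkℚᵘ (pos b) m
  C′ = ℚᵘ.mkℚᵘ (pos C) 0
  c′ = ℚᵘ.mkℚᵘ (pos c) m
  rhs : ℚ.toℚᵘ ((pos a ℚ./ s) ℚ.* (pos b ℚ./ s) ℚ.+ (pos C ℚ./ 1) ℚ.* (pos c ℚ./ s)) ℚᵘ.≃ a′ ℚᵘ.* b′ ℚᵘ.+ C′ ℚᵘ.* c′
  rhs = ℚᵘₚ.≃-trans (ℚₚ.toℚᵘ-homo-+ ((pos a ℚ./ s) ℚ.* (pos b ℚ./ s)) ((pos C ℚ./ 1) ℚ.* (pos c ℚ./ s)))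
    (ℚᵘₚ.+-cong
      (ℚᵘₚ.≃-trans (ℚₚ.toℚᵘ-homo-* (pos a ℚ./ s) (pos b ℚ./ s)) (ℚᵘₚ.*-cong (toℚᵘ-/ a m) (toℚᵘ-/ b m)))
      (ℚᵘₚ.≃-trans (ℚₚ.toℚᵘ-homo-* (pos C ℚ./ 1) (pos c ℚ./ s)) (ℚᵘₚ.*-cong (toℚᵘ-/ C 0) (toℚᵘ-/ c m))))
  -- Unnormalised addition does not cancel, so the common denominator is `s * s * (1 * s)` and the
  -- hypothesis is multiplied by one extra `s`.
  numerators : M * (s * s * (1 * s)) ≤ (a * b * (1 * s) + C * c * (s * s)) * 1
  numerators = begin
    M * (s * s * (1 * s))                          ≡⟨ e₁ M s ⟩
    s * (s * s * M)                                ≤⟨ *-monoʳ-≤ s le ⟩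
    s * (a * b + C * (s * c))                      ≡⟨ e₂ s a b C c ⟩
    (a * b * (1 * s) + C * c * (s * s)) * 1        ∎
    where
    open ≤-Reasoning
    e₁ : ∀ M s → M * (s * s * (1 * s)) ≡ s * (s * s * M)
    e₁ = solve-∀
    e₂ : ∀ s a b C c → s * (a * b + C * (s * c)) ≡ (a * b * (1 * s) + C * c * (s * s)) * 1
    e₂ = solve-∀
  lift : (pos a ℤ.* pos b ℤ.* pos (1 * s) ℤ.+ pos C ℤ.* pos c ℤ.* pos (s * s)) ℤ.* pos 1
       ≡ pos ((a * b * (1 * s) + C * c * (s * s)) * 1)
  lift = trans (cong (ℤ._* pos 1) (cong₂ ℤ._+_
      (trans (cong (ℤ._* pos (1 * s)) (sym (ℤₚ.pos-* a b))) (sym (ℤₚ.pos-* (a * b) (1 * s))))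
      (trans (cong (ℤ._* pos (s * s)) (sym (ℤₚ.pos-* C c))) (sym (ℤₚ.pos-* (C * c) (s * s))))))
    (sym (ℤₚ.pos-* (a * b * (1 * s) + C * c * (s * s)) 1))
  cross : pos M ℤ.* pos (s * s * (1 * s)) ℤ.≤
          (pos a ℤ.* pos b ℤ.* pos (1 * s) ℤ.+ pos C ℤ.* pos c ℤ.* pos (s * s)) ℤ.* pos 1
  cross = subst₂ ℤ._≤_ (ℤₚ.pos-* M (s * s * (1 * s))) (sym lift) (ℤ.+≤+ numerators)

theorem1 : (g h : ℕ) → 2 ≤ h → h ≤ g →
    Σ ℝ λ C → 0ᴿ <ᴿ C ×
    ((n : ℕ) → 1 ≤ n → (A : Subset n) → IsC h g ⟦ A ⟧ →
    fromℕ ∣ A ∣ ≤ᴿ (g ∸ 1) ^[ 1 ÷ h ] *ᴿ n ^[ h ∸ 1 ÷ h ] +ᴿ C *ᴿ n ^[ h ∸ 1 ÷ 2 * h ])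
theorem1 (suc G) (suc d) (s≤s 1≤d) (s≤s d≤G) = fromℕ C
  , (ℚ.1ℚ , ℚₚ.positive⁻¹ ℚ.1ℚ , 0 , λ _ _ → /-mono-≤ 1 0 C 0 (*-monoˡ-≤ 1 1≤C))
  -- From index `n` on, the scale `s = suc m` is at least `n` and `root-bound` applies. The
  -- inequality then holds between the approximants themselves, and `ε` only adds slack.
  , λ n 1≤n A isC ε ε>0 → n , λ m n≤m →
      let s  = suc m
          R₁ = iroot (suc d) (G ^ 1 * s ^ suc d)
          R₂ = iroot (suc d) (n ^ d * s ^ suc d)
          R₃ = iroot (2 * suc d) (n ^ d * s ^ (2 * suc d))
          q  = (pos R₁ ℚ./ s) ℚ.* (pos R₂ ℚ./ s) ℚ.+ (pos C ℚ./ 1) ℚ.* (pos R₃ ℚ./ s)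
      in ℚₚ.≤-trans
        (/-bound ∣ A ∣ R₁ R₂ C R₃ m (root-bound G d A (≤-trans 1≤d d≤G) 1≤n isC s (m≤n⇒m≤1+n n≤m)))
        (subst (ℚ._≤ q ℚ.+ ε) (ℚₚ.+-identityʳ q) (ℚₚ.+-monoʳ-≤ q (ℚₚ.<⇒≤ ε>0)))
  where
  C = 9 * G + 10 + 3 * d
  1≤C : 1 ≤ C
  1≤C = ≤-trans (≤-trans (s≤s z≤n) (m≤n+m 10 (9 * G))) (m≤m+n (9 * G + 10) (3 * d))
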